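{- For each $k\in\{3,4,5,6,7\}$, there is a full-rank $1$-perfect code $C\subseteq\mathbb{F}_3^{13}$ whose kernel has dimension $k$.
   Context: $\mathbb{F}_3$ is the field with three elements. $C\subseteq\mathbb{F}_3^{13}$ is a $1$-perfect code if every vector of $\mathbb{F}_3^{13}$ is uniquely represented as $b+c$ with $c\in C$ and $b$ a vector with at most one nonzero coordinate. $C$ is full-rank if its affine span is $\mathbb{F}_3^{13}$. A period of $C$ is a vector $w$ with $C+w=C$; the kernel of $C$ is the maximal linear subspace contained in the set of periods of $C$. -}

module Defs where

open import Data.Nat using (ℕ)
open import Data.Fin using (Fin; zero; suc)
open import Data.Vec using (Vec; []; _∷_; zipWith; map; replicate; foldr; lookup)
open import Data.List using (List; []; _∷_)
open import Data.List.Relation.Unary.All using (All)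
open import Data.Product using (Σ; _×_; _,_; ∃; proj₁; proj₂)
open import Relation.Binary.PropositionalEquality using (_≡_; _≢_)
open import Relation.Nullary using (¬_)

F₃ : Set
F₃ = Fin 3

infixl 6 _+₃_
infixl 7 _*₃_

_+₃_ : F₃ → F₃ → F₃
zero +₃ y = y
suc zero +₃ zero = suc zero
suc zero +₃ suc zero = suc (suc zero)
suc zero +₃ suc (suc zero) = zero
suc (suc zero) +₃ zero = suc (suc zero)
suc (suc zero) +₃ suc zero = zero
suc (suc zero) +₃ suc (suc zero) = suc zero

_*₃_ : F₃ → F₃ → F₃
zero *₃ y = zero
suc zero *₃ y = y
suc (suc zero) *₃ zero = zero
suc (suc zero) *₃ suc zero = suc (suc zero)
suc (suc zero) *₃ suc (suc zero) = suc zero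

-₃_ : F₃ → F₃
-₃ zero = zero
-₃ suc zero = suc (suc zero)
-₃ suc (suc zero) = suc zero

Word : ℕ → Set
Word n = Vec F₃ n

infixl 6 _⊕_
_⊕_ : ∀ {n} → Word n → Word n → Word n
_⊕_ = zipWith _+₃_

_·_ : ∀ {n} → F₃ → Word n → Word n
a · v = map (a *₃_) v

𝟎 : ∀ {n} → Word n
𝟎 = replicate _ zero

Code : ℕ → Set₁
Code n = Word n → Set

WeightAtMostOne : ∀ {n} → Word n → Set
WeightAtMostOne {n} b =
  ∀ (i j : Fin n) → lookup b i ≢ zero → lookup b j ≢ zero → i ≡ j

IsPerfect1 : ∀ {n} → Code n → Set
IsPerfect1 {n} C =
  ∀ (x : Word n) →
    (Σ (Word n) λ b → Σ (Word n) λ c →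
       WeightAtMostOne b × C c × x ≡ b ⊕ c)
    × (∀ (b c b′ c′ : Word n) →
         WeightAtMostOne b → C c → x ≡ b ⊕ c →
         WeightAtMostOne b′ → C c′ → x ≡ b′ ⊕ c′ →
         (b ≡ b′ × c ≡ c′))

sumCoeffs : ∀ {n} → List (F₃ × Word n) → F₃
sumCoeffs [] = zero
sumCoeffs ((a , _) ∷ xs) = a +₃ sumCoeffs xs

combine : ∀ {n} → List (F₃ × Word n) → Word n
combine [] = 𝟎
combine ((a , v) ∷ xs) = (a · v) ⊕ combine xs

InAffineSpan : ∀ {n} → Code n → Word n → Set
InAffineSpan {n} C x =
  Σ (List (F₃ × Word n)) λ l →
    All (λ p → C (proj₂ p)) l × sumCoeffs l ≡ suc zero × combine l ≡ x

IsFullRank : ∀ {n} → Code n → Set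
IsFullRank {n} C = ∀ (x : Word n) → InAffineSpan C x

IsPeriod : ∀ {n} → Code n → Word n → Set
IsPeriod {n} C w =
  (∀ c → C c → C (c ⊕ w)) ×
  (∀ x → C x → Σ (Word n) λ c → C c × x ≡ c ⊕ w)

IsSubspace : ∀ {n} → (Word n → Set) → Set
IsSubspace {n} K =
  K 𝟎 × (∀ u v → K u → K v → K (u ⊕ v)) × (∀ a v → K v → K (a · v))

_⊆_ : ∀ {n} → (Word n → Set) → (Word n → Set) → Set
_⊆_ {n} P Q = ∀ (x : Word n) → P x → Q x

IsKernel : ∀ {n} → Code n → (Word n → Set) → Set₁
IsKernel {n} C K =
  IsSubspace K × (K ⊆ IsPeriod C) ×
  (∀ (L : Word n → Set) → IsSubspace L → L ⊆ IsPeriod C → L ⊆ K)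

linComb : ∀ {n k} → Vec F₃ k → Vec (Word n) k → Word n
linComb [] [] = 𝟎
linComb (a ∷ as) (v ∷ vs) = (a · v) ⊕ linComb as vs

Span : ∀ {n k} → Vec (Word n) k → Word n → Set
Span {n} {k} B x = Σ (Vec F₃ k) λ λs → linComb λs B ≡ x

LinearlyIndependent : ∀ {n k} → Vec (Word n) k → Set
LinearlyIndependent {n} {k} B =
  ∀ (λs : Vec F₃ k) → linComb λs B ≡ 𝟎 → λs ≡ replicate k zero

HasDimension : ∀ {n} → (Word n → Set) → ℕ → Set
HasDimension {n} K k =
  Σ (Vec (Word n) k) λ B →
    LinearlyIndependent B × (Span B ⊆ K) × (K ⊆ Span B)

{-# OPTIONS --safe #-}
-- Let H x be the syndrome of x for the ternary Hamming code of length 13, whose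
-- coordinates are the points u = (x , y , z) of PG(2,3), and let Y x be further
-- linear syndromes in which the coordinate u has the column φ u, where φ is a tuple
-- of odd polynomials.  For a function ψ, the code C = { x : H x = ψ (Y x) } is
-- 1-perfect exactly when u ↦ u + ψ (q − φ u) is a permutation of F₃³ for every q:
-- an error with syndrome u moves Y by φ u.  If ψ 0 = 0 and no nonzero e satisfies
-- ψ (y + e) = ψ y + ψ e for all y, then the kernel of C is { H = 0 , Y = 0 },
-- of dimension 10 − m for φ with m components.  C has full rank as soon as the
-- defects of additivity ψ (y + y′) − ψ y − ψ y′ span F₃³.
-- A single ψ in seven variables serves all k: for m = 10 − k < 7 the last
-- variables are set to 0.
module Submission where

open import Defs
open import Data.Nat using (ℕ; zero; suc; _+_; _≤_; s≤s)
open import Data.Product using (Σ; _×_; _,_; proj₁; proj₂)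
open import Algebra.Properties.CommutativeSemigroup using (interchange)
open import Algebra.Structures using (IsCommutativeSemigroup)
open import Data.Bool using (if_then_else_; true; false)
open import Data.Empty using (⊥-elim)
open import Data.Fin using (zero; suc)
open import Data.Fin.Properties using (_≟_; all?; suc-injective; 0≢1+n)
open import Data.List using (List; []; _∷_)
import Data.List as List
import Data.List.Relation.Unary.All as ListAll
open ListAll using ([]; _∷_)
open import Data.List.Relation.Unary.All.Properties using (++⁺; map⁺)
open import Data.Vec using (Vec; []; _∷_; _++_; map; zipWith; replicate; lookup; take; drop; _[_]%=_)
open import Data.Vec.Properties using (≡-dec; zipWith-assoc; zipWith-comm; zipWith-identityˡ; zipWith-identityʳ; zipWith-++; map-++; take-zipWith; drop-zipWith; take-map; drop-map; take++drop≡id; ++-injective; lookup-replicate)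
import Data.Vec.Relation.Unary.All as All
open All using (All)
open import Relation.Binary.PropositionalEquality using (_≡_; _≢_; refl; sym; trans; cong; cong₂; subst; isEquivalence; module ≡-Reasoning)
open import Relation.Nullary using (¬_; Dec; does)
open import Relation.Nullary.Decidable using (toWitness; from-yes; map′; _×-dec_; _→-dec_)

open ≡-Reasoning

pattern 𝟘 = zero
pattern 𝟙 = suc zero
pattern 𝟚 = suc (suc zero)

-- Linear algebra over F₃

+₃-assoc : ∀ a b c → (a +₃ b) +₃ c ≡ a +₃ (b +₃ c)
+₃-assoc = from-yes (all? λ a → all? λ b → all? λ c → (a +₃ b) +₃ c ≟ a +₃ (b +₃ c))

+₃-comm : ∀ a b → a +₃ b ≡ b +₃ a
+₃-comm = from-yes (all? λ a → all? λ b → a +₃ b ≟ b +₃ a)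

+₃-identityʳ : ∀ a → a +₃ 𝟘 ≡ a
+₃-identityʳ = from-yes (all? λ a → a +₃ 𝟘 ≟ a)

*₃-distribˡ : ∀ a b c → a *₃ (b +₃ c) ≡ a *₃ b +₃ a *₃ c
*₃-distribˡ = from-yes (all? λ a → all? λ b → all? λ c → a *₃ (b +₃ c) ≟ a *₃ b +₃ a *₃ c)

*₃-distribʳ : ∀ a b c → (a +₃ b) *₃ c ≡ a *₃ c +₃ b *₃ c
*₃-distribʳ = from-yes (all? λ a → all? λ b → all? λ c → (a +₃ b) *₃ c ≟ a *₃ c +₃ b *₃ c)

*₃-assoc : ∀ a b c → (a *₃ b) *₃ c ≡ a *₃ (b *₃ c)
*₃-assoc = from-yes (all? λ a → all? λ b → all? λ c → (a *₃ b) *₃ c ≟ a *₃ (b *₃ c))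

*₃-zeroʳ : ∀ a → a *₃ 𝟘 ≡ 𝟘
*₃-zeroʳ = from-yes (all? λ a → a *₃ 𝟘 ≟ 𝟘)

*₃-identityʳ : ∀ a → a *₃ 𝟙 ≡ a
*₃-identityʳ = from-yes (all? λ a → a *₃ 𝟙 ≟ a)

⊕-assoc : ∀ {n} (u v w : Word n) → (u ⊕ v) ⊕ w ≡ u ⊕ (v ⊕ w)
⊕-assoc = zipWith-assoc +₃-assoc

⊕-comm : ∀ {n} (v w : Word n) → v ⊕ w ≡ w ⊕ v
⊕-comm = zipWith-comm +₃-comm

⊕-identityˡ : ∀ {n} (v : Word n) → 𝟎 ⊕ v ≡ v
⊕-identityˡ = zipWith-identityˡ (λ _ → refl)

⊕-identityʳ : ∀ {n} (v : Word n) → v ⊕ 𝟎 ≡ v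
⊕-identityʳ = zipWith-identityʳ +₃-identityʳ

⊕-interchange : ∀ {n} (a b c d : Word n) → (a ⊕ b) ⊕ (c ⊕ d) ≡ (a ⊕ c) ⊕ (b ⊕ d)
⊕-interchange {n} = interchange (record { isCommutativeSemigroup = isCommutativeSemigroup })
  where
  isCommutativeSemigroup : IsCommutativeSemigroup {A = Word n} _≡_ _⊕_
  isCommutativeSemigroup = record
    { isSemigroup = record
      { isMagma = record { isEquivalence = isEquivalence ; ∙-cong = cong₂ _⊕_ }
      ; assoc = ⊕-assoc }
    ; comm = ⊕-comm }

·-⊕ : ∀ {n} a (v w : Word n) → a · (v ⊕ w) ≡ a · v ⊕ a · w
·-⊕ a [] [] = refl
·-⊕ a (b ∷ v) (c ∷ w) = cong₂ _∷_ (*₃-distribˡ a b c) (·-⊕ a v w)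

+₃-· : ∀ {n} a b (v : Word n) → (a +₃ b) · v ≡ a · v ⊕ b · v
+₃-· a b [] = refl
+₃-· a b (c ∷ v) = cong₂ _∷_ (*₃-distribʳ a b c) (+₃-· a b v)

*₃-· : ∀ {n} a b (v : Word n) → (a *₃ b) · v ≡ a · (b · v)
*₃-· a b [] = refl
*₃-· a b (c ∷ v) = cong₂ _∷_ (*₃-assoc a b c) (*₃-· a b v)

·-𝟎 : ∀ {n} a → a · 𝟎 {n} ≡ 𝟎
·-𝟎 {zero} a = refl
·-𝟎 {suc n} a = cong₂ _∷_ (*₃-zeroʳ a) (·-𝟎 a)

zero-· : ∀ {n} (v : Word n) → 𝟘 · v ≡ 𝟎
zero-· [] = refl
zero-· (a ∷ v) = cong (𝟘 ∷_) (zero-· v)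

one-· : ∀ {n} (v : Word n) → 𝟙 · v ≡ v
one-· [] = refl
one-· (a ∷ v) = cong (a ∷_) (one-· v)

-- Since -1 = 2 in F₃, subtraction of words is written throughout as adding `𝟚 · w`.
⊕-inverseʳ : ∀ {n} (v : Word n) → v ⊕ 𝟚 · v ≡ 𝟎
⊕-inverseʳ v = begin
  v ⊕ 𝟚 · v      ≡⟨ cong (_⊕ 𝟚 · v) (one-· v) ⟨
  𝟙 · v ⊕ 𝟚 · v  ≡⟨ +₃-· 𝟙 𝟚 v ⟨
  𝟘 · v          ≡⟨ zero-· v ⟩
  𝟎              ∎

⊕-⊖ : ∀ {n} (v w : Word n) → (v ⊕ w) ⊕ 𝟚 · w ≡ v
⊕-⊖ v w = begin
  (v ⊕ w) ⊕ 𝟚 · w  ≡⟨ ⊕-assoc v w (𝟚 · w) ⟩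
  v ⊕ (w ⊕ 𝟚 · w)  ≡⟨ cong (v ⊕_) (⊕-inverseʳ w) ⟩
  v ⊕ 𝟎            ≡⟨ ⊕-identityʳ v ⟩
  v                ∎

⊖-⊕ : ∀ {n} (v w : Word n) → (v ⊕ 𝟚 · w) ⊕ w ≡ v
⊖-⊕ v w = begin
  (v ⊕ 𝟚 · w) ⊕ w  ≡⟨ ⊕-assoc v (𝟚 · w) w ⟩
  v ⊕ (𝟚 · w ⊕ w)  ≡⟨ cong (v ⊕_) (trans (⊕-comm (𝟚 · w) w) (⊕-inverseʳ w)) ⟩
  v ⊕ 𝟎            ≡⟨ ⊕-identityʳ v ⟩
  v                ∎

linComb-⊕ : ∀ {n j} (x y : Word j) (V : Vec (Word n) j) →
  linComb (x ⊕ y) V ≡ linComb x V ⊕ linComb y V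
linComb-⊕ [] [] [] = sym (⊕-identityˡ 𝟎)
linComb-⊕ (a ∷ x) (b ∷ y) (v ∷ V) = begin
  (a +₃ b) · v ⊕ linComb (x ⊕ y) V                     ≡⟨ cong₂ _⊕_ (+₃-· a b v) (linComb-⊕ x y V) ⟩
  (a · v ⊕ b · v) ⊕ (linComb x V ⊕ linComb y V)        ≡⟨ ⊕-interchange (a · v) (b · v) _ _ ⟩
  (a · v ⊕ linComb x V) ⊕ (b · v ⊕ linComb y V)        ∎

linComb-· : ∀ {n j} a (x : Word j) (V : Vec (Word n) j) → linComb (a · x) V ≡ a · linComb x V
linComb-· a [] [] = sym (·-𝟎 a)
linComb-· a (b ∷ x) (v ∷ V) = begin
  (a *₃ b) · v ⊕ linComb (a · x) V    ≡⟨ cong₂ _⊕_ (*₃-· a b v) (linComb-· a x V) ⟩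
  a · (b · v) ⊕ a · linComb x V       ≡⟨ ·-⊕ a (b · v) (linComb x V) ⟨
  a · (b · v ⊕ linComb x V)           ∎

linComb-𝟎 : ∀ {n j} (V : Vec (Word n) j) → linComb 𝟎 V ≡ 𝟎
linComb-𝟎 [] = refl
linComb-𝟎 (v ∷ V) = trans (cong₂ _⊕_ (zero-· v) (linComb-𝟎 V)) (⊕-identityˡ 𝟎)

linComb-++ : ∀ {n i j} (x : Word i) (y : Word j) (V : Vec (Word n) i) (W : Vec (Word n) j) →
  linComb (x ++ y) (V ++ W) ≡ linComb x V ⊕ linComb y W
linComb-++ [] y [] W = sym (⊕-identityˡ _)
linComb-++ (a ∷ x) y (v ∷ V) W =
  trans (cong (a · v ⊕_) (linComb-++ x y V W)) (sym (⊕-assoc (a · v) _ _))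

infixl 7 _⊡_

-- A vector of words is a matrix given by its rows, and `linComb x A` is the row vector x times A.
-- This is then the matrix product A B.
_⊡_ : ∀ {i j n} → Vec (Word j) i → Vec (Word n) j → Vec (Word n) i
A ⊡ B = map (λ r → linComb r B) A

linComb-⊡ : ∀ {i j n} (x : Word i) (A : Vec (Word j) i) (B : Vec (Word n) j) →
  linComb (linComb x A) B ≡ linComb x (A ⊡ B)
linComb-⊡ [] [] B = linComb-𝟎 B
linComb-⊡ (a ∷ x) (r ∷ A) B = begin
  linComb (a · r ⊕ linComb x A) B                  ≡⟨ linComb-⊕ (a · r) (linComb x A) B ⟩
  linComb (a · r) B ⊕ linComb (linComb x A) B      ≡⟨ cong₂ _⊕_ (linComb-· a r B) (linComb-⊡ x A B) ⟩
  a · linComb r B ⊕ linComb x (A ⊡ B)              ∎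

identity : ∀ {n} → Vec (Word n) n
identity {zero} = []
identity {suc n} = (𝟙 ∷ 𝟎) ∷ map (𝟘 ∷_) identity

linComb-shift : ∀ {n j} (x : Word j) (V : Vec (Word n) j) →
  linComb x (map (𝟘 ∷_) V) ≡ 𝟘 ∷ linComb x V
linComb-shift [] [] = refl
linComb-shift (a ∷ x) (v ∷ V) =
  trans (cong (a · (𝟘 ∷ v) ⊕_) (linComb-shift x V))
        (cong (_∷ (a · v ⊕ linComb x V)) (trans (+₃-identityʳ (a *₃ 𝟘)) (*₃-zeroʳ a)))

linComb-identity : ∀ {n} (x : Word n) → linComb x identity ≡ x
linComb-identity [] = refl
linComb-identity (a ∷ x) = begin
  a · (𝟙 ∷ 𝟎) ⊕ linComb x (map (𝟘 ∷_) identity)  ≡⟨ cong (a · (𝟙 ∷ 𝟎) ⊕_) (linComb-shift x identity) ⟩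
  (a *₃ 𝟙 +₃ 𝟘) ∷ (a · 𝟎 ⊕ linComb x identity)   ≡⟨ cong₂ _∷_ (trans (+₃-identityʳ _) (*₃-identityʳ a)) (cong₂ _⊕_ (·-𝟎 a) (linComb-identity x)) ⟩
  a ∷ (𝟎 ⊕ x)                                    ≡⟨ cong (a ∷_) (⊕-identityˡ x) ⟩
  a ∷ x                                          ∎

linComb-inverse : ∀ {i j} {A : Vec (Word j) i} {B : Vec (Word i) j} → A ⊡ B ≡ identity →
  ∀ x → linComb (linComb x A) B ≡ x
linComb-inverse {A = A} {B} AB≡I x = begin
  linComb (linComb x A) B  ≡⟨ linComb-⊡ x A B ⟩
  linComb x (A ⊡ B)        ≡⟨ cong (linComb x) AB≡I ⟩
  linComb x identity       ≡⟨ linComb-identity x ⟩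
  x                        ∎

take-++ : ∀ {A : Set} {i j} (v : Vec A i) (w : Vec A j) → take i (v ++ w) ≡ v
take-++ {i = i} v w = proj₁ (++-injective _ v (take++drop≡id i (v ++ w)))

drop-++ : ∀ {A : Set} {i j} (v : Vec A i) (w : Vec A j) → drop i (v ++ w) ≡ w
drop-++ {i = i} v w = proj₂ (++-injective _ v (take++drop≡id i (v ++ w)))

𝟎-++ : ∀ i {j} → 𝟎 {i} ++ 𝟎 {j} ≡ 𝟎
𝟎-++ zero = refl
𝟎-++ (suc i) = cong (𝟘 ∷_) (𝟎-++ i)

-- Words of weight at most one

-- An inductive form of `WeightAtMostOne`: an exhaustive check by recursion over it visits 3n + 1
-- words instead of 3ⁿ.
data Sparse : ∀ {n} → Word n → Set where
  []    : Sparse []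
  here  : ∀ {n} a → Sparse {suc n} (a ∷ 𝟎)
  there : ∀ {n} {w : Word n} → Sparse w → Sparse (𝟘 ∷ w)

sparse⇒weight≤1 : ∀ {n} {b : Word n} → Sparse b → WeightAtMostOne b
sparse⇒weight≤1 (here a) zero zero _ _ = refl
sparse⇒weight≤1 (here a) (suc i) _ p _ = ⊥-elim (p (lookup-replicate i 𝟘))
sparse⇒weight≤1 (here a) zero (suc j) _ q = ⊥-elim (q (lookup-replicate j 𝟘))
sparse⇒weight≤1 (there s) zero _ p _ = ⊥-elim (p refl)
sparse⇒weight≤1 (there s) (suc i) zero _ q = ⊥-elim (q refl)
sparse⇒weight≤1 (there s) (suc i) (suc j) p q = cong suc (sparse⇒weight≤1 s i j p q)

no-nonzero⇒𝟎 : ∀ {n} (w : Word n) → (∀ i → ¬ lookup w i ≢ 𝟘) → w ≡ 𝟎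
no-nonzero⇒𝟎 [] _ = refl
no-nonzero⇒𝟎 (zero ∷ w) h = cong (𝟘 ∷_) (no-nonzero⇒𝟎 w λ i → h (suc i))
no-nonzero⇒𝟎 (suc a ∷ w) h = ⊥-elim (h zero λ ())

weight≤1⇒sparse : ∀ {n} (b : Word n) → WeightAtMostOne b → Sparse b
weight≤1⇒sparse [] _ = []
weight≤1⇒sparse (zero ∷ b) h =
  there (weight≤1⇒sparse b λ i j p q → suc-injective (h (suc i) (suc j) p q))
weight≤1⇒sparse (suc a ∷ b) h =
  subst (λ w → Sparse (suc a ∷ w)) (sym b≡𝟎) (here (suc a))
  where
  b≡𝟎 : b ≡ 𝟎
  b≡𝟎 = no-nonzero⇒𝟎 b λ i p → 0≢1+n (h zero (suc i) (λ ()) p)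

-- Exhaustive search

infix 4 _≟ʷ_

_≟ʷ_ : ∀ {n} (v w : Word n) → Dec (v ≡ w)
_≟ʷ_ = ≡-dec _≟_

allWords? : ∀ {n} {P : Word n → Set} → (∀ w → Dec (P w)) → Dec (∀ w → P w)
allWords? {zero} P? = map′ (λ { p [] → p }) (λ p → p []) (P? [])
allWords? {suc n} P? =
  map′ (λ { (p , q , r) (zero ∷ w) → p w
          ; (p , q , r) (𝟙 ∷ w) → q w
          ; (p , q , r) (𝟚 ∷ w) → r w })
       (λ p → (λ w → p _) , (λ w → p _) , (λ w → p _))
       (allWords? (λ w → P? (𝟘 ∷ w)) ×-dec allWords? (λ w → P? (𝟙 ∷ w)) ×-dec allWords? (λ w → P? (𝟚 ∷ w)))

allSparse? : ∀ {n} {P : Word n → Set} → (∀ w → Dec (P w)) → Dec (∀ w → Sparse w → P w)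
allSparse? {zero} P? = map′ (λ { p _ [] → p }) (λ p → p [] []) (P? [])
allSparse? {suc n} P? =
  map′ (λ { (p , q) _ (here a) → p a ; (p , q) _ (there s) → q _ s })
       (λ p → (λ a → p _ (here a)) , (λ w s → p _ (there s)))
       (all? (λ a → P? (a ∷ 𝟎)) ×-dec allSparse? (λ w → P? (𝟘 ∷ w)))

foldWords : ∀ {n} {A : Set} → (Word n → A → A) → A → A
foldWords {zero} f z = f [] z
foldWords {suc n} f z =
  foldWords (λ w → f (𝟘 ∷ w)) (foldWords (λ w → f (𝟙 ∷ w)) (foldWords (λ w → f (𝟚 ∷ w)) z))

Table : Set
Table = Vec (Vec (Vec (Word 3) 3) 3) 3

infixl 5 _at_

_at_ : Table → Word 3 → Word 3
t at (a ∷ b ∷ c ∷ []) = lookup (lookup (lookup t a) b) c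

set : Word 3 → Word 3 → Table → Table
set (a ∷ b ∷ c ∷ []) u t = t [ a ]%= λ t₁ → t₁ [ b ]%= λ t₂ → t₂ [ c ]%= λ _ → u

-- A candidate inverse, obtained by storing u at position `g u` for all 27 words u; whether it
-- inverts g is decided by `inverseTable?`. With a table, that check needs 54 look-ups and no search
-- for preimages.
tabulateInverse : (Word 3 → Word 3) → Table
tabulateInverse g = foldWords (λ u → set (g u) u) (replicate 3 (replicate 3 (replicate 3 𝟎)))

InverseTable : (Word 3 → Word 3) → Table → Set
InverseTable g t = (∀ u → t at g u ≡ u) × (∀ h → g (t at h) ≡ h)

inverseTable? : ∀ g t → Dec (InverseTable g t)
inverseTable? g t = allWords? (λ u → t at g u ≟ʷ u) ×-dec allWords? (λ h → g (t at h) ≟ʷ h)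

-- The code { H x = ψ (Y x) }

-- The value that `H x` must have if x = b + c with c in the code, where u = `H b`, q = `Y x` and
-- `Y b` = φ u. If it permutes the u for each q, then `H x` and `Y x` determine exactly one error
-- syndrome.
translate : ∀ {m} → (Word 3 → Word m) → (Word m → Word 3) → Word m → Word 3 → Word 3
translate φ ψ q u = u ⊕ ψ (q ⊕ 𝟚 · φ u)

Permutes : ∀ {m} → (Word 3 → Word m) → (Word m → Word 3) → Set
Permutes φ ψ = ∀ q → InverseTable (translate φ ψ q) (tabulateInverse (translate φ ψ q))

permutes? : ∀ {m} (φ : Word 3 → Word m) (ψ : Word m → Word 3) → Dec (Permutes φ ψ)
permutes? φ ψ = allWords? λ q → inverseTable? (translate φ ψ q) (tabulateInverse (translate φ ψ q))

-- Additivity of e is tested against the unit vectors y only. This makes the property stronger than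
-- the same one with all y, and cheaper to decide.
Aperiodic : ∀ {m} → (Word m → Word 3) → Set
Aperiodic ψ = ∀ e → All (λ y → ψ (y ⊕ e) ≡ ψ y ⊕ ψ e) identity → e ≡ 𝟎

aperiodic? : ∀ {m} (ψ : Word m → Word 3) → Dec (Aperiodic ψ)
aperiodic? ψ = allWords? λ e → All.all? (λ y → ψ (y ⊕ e) ≟ʷ ψ y ⊕ ψ e) identity →-dec e ≟ʷ 𝟎

defect : ∀ {m} → (Word m → Word 3) → Word m → Word m → Word 3
defect ψ y y′ = ψ (y ⊕ y′) ⊕ 𝟚 · (ψ y ⊕ ψ y′)

-- As `M` and `R` are inverse to each other, x ↦ (H x , Y x , Z x) is a linear change of coordinates
-- with blocks of lengths 3, m and k, undone by `join`. In these coordinates C is a graph: its words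
-- are `join (ψ y) y z`, with y and z arbitrary.
module SyndromeCode
  {n} (m k : ℕ)
  (M : Vec (Word (3 + (m + k))) n) (R : Vec (Word n) (3 + (m + k)))
  (M⊡R≡I : M ⊡ R ≡ identity) (R⊡M≡I : R ⊡ M ≡ identity)
  (ψ : Word m → Word 3) (ψ-𝟎 : ψ 𝟎 ≡ 𝟎)
  where

  T : Word n → Word (3 + (m + k))
  T x = linComb x M

  H : Word n → Word 3
  H x = take 3 (T x)

  Y : Word n → Word m
  Y x = take m (drop 3 (T x))

  Z : Word n → Word k
  Z x = drop m (drop 3 (T x))

  C : Code n
  C x = H x ≡ ψ (Y x)

  H-⊕ : ∀ x y → H (x ⊕ y) ≡ H x ⊕ H y
  H-⊕ x y = trans (cong (take 3) (linComb-⊕ x y M)) (take-zipWith _+₃_ (T x) (T y))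

  H-· : ∀ a x → H (a · x) ≡ a · H x
  H-· a x = trans (cong (take 3) (linComb-· a x M)) (take-map (a *₃_) 3 (T x))

  Y-⊕ : ∀ x y → Y (x ⊕ y) ≡ Y x ⊕ Y y
  Y-⊕ x y = begin
    take m (drop 3 (T (x ⊕ y)))              ≡⟨ cong (λ t → take m (drop 3 t)) (linComb-⊕ x y M) ⟩
    take m (drop 3 (T x ⊕ T y))              ≡⟨ cong (take m) (drop-zipWith {m = 3} _+₃_ (T x) (T y)) ⟩
    take m (drop 3 (T x) ⊕ drop 3 (T y))     ≡⟨ take-zipWith _+₃_ (drop 3 (T x)) (drop 3 (T y)) ⟩
    Y x ⊕ Y y                                ∎

  Y-· : ∀ a x → Y (a · x) ≡ a · Y x
  Y-· a x = begin
    take m (drop 3 (T (a · x)))    ≡⟨ cong (λ t → take m (drop 3 t)) (linComb-· a x M) ⟩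
    take m (drop 3 (a · T x))      ≡⟨ cong (take m) (drop-map (a *₃_) 3 (T x)) ⟩
    take m (a · drop 3 (T x))      ≡⟨ take-map (a *₃_) m (drop 3 (T x)) ⟩
    a · Y x                        ∎

  join : Word 3 → Word m → Word k → Word n
  join h y z = linComb (h ++ (y ++ z)) R

  T-join : ∀ h y z → T (join h y z) ≡ h ++ (y ++ z)
  T-join h y z = linComb-inverse R⊡M≡I (h ++ (y ++ z))

  H-join : ∀ h y z → H (join h y z) ≡ h
  H-join h y z = trans (cong (take 3) (T-join h y z)) (take-++ h (y ++ z))

  YZ-join : ∀ h y z → drop 3 (T (join h y z)) ≡ y ++ z
  YZ-join h y z = trans (cong (drop 3) (T-join h y z)) (drop-++ h (y ++ z))

  Y-join : ∀ h y z → Y (join h y z) ≡ y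
  Y-join h y z = trans (cong (take m) (YZ-join h y z)) (take-++ y z)

  Z-join : ∀ h y z → Z (join h y z) ≡ z
  Z-join h y z = trans (cong (drop m) (YZ-join h y z)) (drop-++ y z)

  join-HYZ : ∀ x → join (H x) (Y x) (Z x) ≡ x
  join-HYZ x = begin
    linComb (H x ++ (Y x ++ Z x)) R      ≡⟨ cong (λ w → linComb (H x ++ w) R) (take++drop≡id m (drop 3 (T x))) ⟩
    linComb (H x ++ drop 3 (T x)) R      ≡⟨ cong (λ w → linComb w R) (take++drop≡id 3 (T x)) ⟩
    linComb (T x) R                      ≡⟨ linComb-inverse M⊡R≡I x ⟩
    x                                    ∎

  join-⊕ : ∀ h y z h′ y′ z′ → join h y z ⊕ join h′ y′ z′ ≡ join (h ⊕ h′) (y ⊕ y′) (z ⊕ z′)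
  join-⊕ h y z h′ y′ z′ = begin
    join h y z ⊕ join h′ y′ z′                       ≡⟨ linComb-⊕ (h ++ (y ++ z)) (h′ ++ (y′ ++ z′)) R ⟨
    linComb ((h ++ (y ++ z)) ⊕ (h′ ++ (y′ ++ z′))) R ≡⟨ cong (λ w → linComb w R) (zipWith-++ _+₃_ h (y ++ z) h′ (y′ ++ z′)) ⟩
    linComb ((h ⊕ h′) ++ ((y ++ z) ⊕ (y′ ++ z′))) R  ≡⟨ cong (λ w → linComb ((h ⊕ h′) ++ w) R) (zipWith-++ _+₃_ y z y′ z′) ⟩
    join (h ⊕ h′) (y ⊕ y′) (z ⊕ z′)                  ∎

  join-· : ∀ a h y z → a · join h y z ≡ join (a · h) (a · y) (a · z)
  join-· a h y z = begin
    a · join h y z                            ≡⟨ linComb-· a (h ++ (y ++ z)) R ⟨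
    linComb (a · (h ++ (y ++ z))) R           ≡⟨ cong (λ w → linComb w R) (map-++ (a *₃_) h (y ++ z)) ⟩
    linComb (a · h ++ a · (y ++ z)) R         ≡⟨ cong (λ w → linComb (a · h ++ w) R) (map-++ (a *₃_) y z) ⟩
    join (a · h) (a · y) (a · z)              ∎

  join-ψ∈C : ∀ y z → C (join (ψ y) y z)
  join-ψ∈C y z = trans (H-join (ψ y) y z) (cong ψ (sym (Y-join (ψ y) y z)))

  H-𝟎 : H 𝟎 ≡ 𝟎
  H-𝟎 = trans (cong (take 3) (trans (linComb-𝟎 M) (sym (𝟎-++ 3)))) (take-++ (𝟎 {3}) (𝟎 {m + k}))

  Y-𝟎 : Y 𝟎 ≡ 𝟎
  Y-𝟎 = begin
    take m (drop 3 (T 𝟎))          ≡⟨ cong (λ t → take m (drop 3 t)) (linComb-𝟎 M) ⟩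
    take m (𝟎 {m + k})             ≡⟨ cong (take m) (𝟎-++ m) ⟨
    take m (𝟎 {m} ++ 𝟎 {k})        ≡⟨ take-++ (𝟎 {m}) (𝟎 {k}) ⟩
    𝟎                              ∎

  -- Unique decoding

  module Perfect
    (φ : Word 3 → Word m) (permutes : Permutes φ ψ)
    (error : Word 3 → Word n) (error-sparse : ∀ u → Sparse (error u))
    (H-error : ∀ u → H (error u) ≡ u) (Y-error : ∀ u → Y (error u) ≡ φ u)
    (error-H : ∀ b → Sparse b → error (H b) ≡ b)
    where

    translate-injective : ∀ q u u′ → translate φ ψ q u ≡ translate φ ψ q u′ → u ≡ u′
    translate-injective q u u′ eq = begin
      u                        ≡⟨ proj₁ (permutes q) u ⟨
      t at translate φ ψ q u   ≡⟨ cong (t at_) eq ⟩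
      t at translate φ ψ q u′  ≡⟨ proj₁ (permutes q) u′ ⟩
      u′                       ∎
      where t = tabulateInverse (translate φ ψ q)

    decode : ∀ x → Σ (Word n) λ b → Σ (Word n) λ c → WeightAtMostOne b × C c × x ≡ b ⊕ c
    decode x = error u , x ⊕ 𝟚 · error u , sparse⇒weight≤1 (error-sparse u) , c∈C ,
      sym (trans (⊕-comm (error u) _) (⊖-⊕ x (error u)))
      where
      -- The syndrome of the error is found by inverting the permutation that belongs to `Y x`.
      u : Word 3
      u = tabulateInverse (translate φ ψ (Y x)) at H x
      Hx≡ : u ⊕ ψ (Y x ⊕ 𝟚 · φ u) ≡ H x
      Hx≡ = proj₂ (permutes (Y x)) (H x)
      c∈C : H (x ⊕ 𝟚 · error u) ≡ ψ (Y (x ⊕ 𝟚 · error u))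
      c∈C = begin
        H (x ⊕ 𝟚 · error u)                    ≡⟨ H-⊕ x _ ⟩
        H x ⊕ H (𝟚 · error u)                  ≡⟨ cong (H x ⊕_) (trans (H-· 𝟚 (error u)) (cong (𝟚 ·_) (H-error u))) ⟩
        H x ⊕ 𝟚 · u                            ≡⟨ cong (_⊕ 𝟚 · u) (trans (sym Hx≡) (⊕-comm u _)) ⟩
        (ψ (Y x ⊕ 𝟚 · φ u) ⊕ u) ⊕ 𝟚 · u        ≡⟨ ⊕-⊖ _ u ⟩
        ψ (Y x ⊕ 𝟚 · φ u)                      ≡⟨ cong (λ w → ψ (Y x ⊕ w)) (trans (Y-· 𝟚 (error u)) (cong (𝟚 ·_) (Y-error u))) ⟨
        ψ (Y x ⊕ Y (𝟚 · error u))              ≡⟨ cong ψ (Y-⊕ x _) ⟨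
        ψ (Y (x ⊕ 𝟚 · error u))                ∎

    -- A sparse b is the error with syndrome `H b`, so `Y b` = φ (H b). Hence ψ is evaluated at
    -- `Y x` - `Y b` = `Y c`, where it equals `H c`.
    translate-Hb : ∀ {x b c} → Sparse b → C c → x ≡ b ⊕ c → translate φ ψ (Y x) (H b) ≡ H x
    translate-Hb {x} {b} {c} sb c∈C refl = begin
      H b ⊕ ψ (Y (b ⊕ c) ⊕ 𝟚 · φ (H b))      ≡⟨ cong (λ w → H b ⊕ ψ (Y (b ⊕ c) ⊕ 𝟚 · w)) φHb≡Yb ⟩
      H b ⊕ ψ (Y (b ⊕ c) ⊕ 𝟚 · Y b)          ≡⟨ cong (λ w → H b ⊕ ψ (w ⊕ 𝟚 · Y b)) (trans (Y-⊕ b c) (⊕-comm (Y b) (Y c))) ⟩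
      H b ⊕ ψ ((Y c ⊕ Y b) ⊕ 𝟚 · Y b)        ≡⟨ cong (λ w → H b ⊕ ψ w) (⊕-⊖ (Y c) (Y b)) ⟩
      H b ⊕ ψ (Y c)                          ≡⟨ cong (H b ⊕_) c∈C ⟨
      H b ⊕ H c                              ≡⟨ H-⊕ b c ⟨
      H (b ⊕ c)                              ∎
      where
      φHb≡Yb : φ (H b) ≡ Y b
      φHb≡Yb = trans (sym (Y-error (H b))) (cong Y (error-H b sb))

    -- Both `H b` and `H b′` are mapped to `H x` by the same permutation, so they agree, and a
    -- sparse word is recovered from its syndrome.
    decode-unique : ∀ x b c b′ c′ →
      WeightAtMostOne b → C c → x ≡ b ⊕ c →
      WeightAtMostOne b′ → C c′ → x ≡ b′ ⊕ c′ → b ≡ b′ × c ≡ c′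
    decode-unique x b c b′ c′ wb c∈C x≡ wb′ c′∈C x≡′ = b≡b′ , c≡c′
      where
      sb : Sparse b
      sb = weight≤1⇒sparse b wb
      sb′ : Sparse b′
      sb′ = weight≤1⇒sparse b′ wb′
      b≡b′ : b ≡ b′
      b≡b′ = begin
        b             ≡⟨ error-H b sb ⟨
        error (H b)   ≡⟨ cong error (translate-injective (Y x) (H b) (H b′) (trans (translate-Hb sb c∈C x≡) (sym (translate-Hb sb′ c′∈C x≡′)))) ⟩
        error (H b′)  ≡⟨ error-H b′ sb′ ⟩
        b′            ∎
      c≡c′ : c ≡ c′
      c≡c′ = begin
        c                      ≡⟨ ⊕-⊖ c b ⟨
        (c ⊕ b) ⊕ 𝟚 · b        ≡⟨ cong (_⊕ 𝟚 · b) (trans (⊕-comm c b) (trans (sym x≡) (trans x≡′ (⊕-comm b′ c′)))) ⟩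
        (c′ ⊕ b′) ⊕ 𝟚 · b      ≡⟨ cong (λ w → (c′ ⊕ b′) ⊕ 𝟚 · w) b≡b′ ⟩
        (c′ ⊕ b′) ⊕ 𝟚 · b′     ≡⟨ ⊕-⊖ c′ b′ ⟩
        c′                     ∎

    isPerfect1 : IsPerfect1 C
    isPerfect1 x = decode x , decode-unique x

  -- Linear and affine span of the code

  InSpan : Word n → Set
  InSpan x = Σ (List (F₃ × Word n)) λ l → ListAll.All (λ p → C (proj₂ p)) l × combine l ≡ x

  C⊆span : ∀ {x} → C x → InSpan x
  C⊆span {x} x∈C = (𝟙 , x) ∷ [] , x∈C ∷ [] , trans (⊕-identityʳ (𝟙 · x)) (one-· x)

  span-⊕ : ∀ {x y} → InSpan x → InSpan y → InSpan (x ⊕ y)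
  span-⊕ (l , l⊆C , refl) (l′ , l′⊆C , refl) = l List.++ l′ , ++⁺ l⊆C l′⊆C , combine-++ l
    where
    combine-++ : ∀ l → combine (l List.++ l′) ≡ combine l ⊕ combine l′
    combine-++ [] = sym (⊕-identityˡ _)
    combine-++ ((a , v) ∷ l) = trans (cong (a · v ⊕_) (combine-++ l)) (sym (⊕-assoc (a · v) _ _))

  span-· : ∀ a {x} → InSpan x → InSpan (a · x)
  span-· a (l , l⊆C , refl) = List.map scale l , map⁺ l⊆C , combine-scale l
    where
    scale : F₃ × Word n → F₃ × Word n
    scale (b , v) = a *₃ b , v
    combine-scale : ∀ l → combine (List.map scale l) ≡ a · combine l
    combine-scale [] = sym (·-𝟎 a)
    combine-scale ((b , v) ∷ l) =
      trans (cong₂ _⊕_ (*₃-· a b v) (combine-scale l)) (sym (·-⊕ a (b · v) (combine l)))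

  𝟎∈C : C 𝟎
  𝟎∈C = trans H-𝟎 (sym (trans (cong ψ Y-𝟎) ψ-𝟎))

  -- The zero word lies in C, so it can be added with whatever coefficient brings the sum of the
  -- coefficients to 1.
  span⊆affineSpan : ∀ {x} → InSpan x → InAffineSpan C x
  span⊆affineSpan (l , l⊆C , refl) =
    (𝟙 +₃ -₃ s , 𝟎) ∷ l , 𝟎∈C ∷ l⊆C , complete s ,
    trans (cong (_⊕ combine l) (·-𝟎 (𝟙 +₃ -₃ s))) (⊕-identityˡ _)
    where
    s : F₃
    s = sumCoeffs l
    complete : ∀ s → (𝟙 +₃ -₃ s) +₃ s ≡ 𝟙
    complete = from-yes (all? λ s → (𝟙 +₃ -₃ s) +₃ s ≟ 𝟙)

  -- Take the code word over y + y′ and subtract those over y and y′: the `Y` parts cancel and the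
  -- defect of additivity remains in the `H` part.
  defect∈span : ∀ y y′ → InSpan (join (defect ψ y y′) 𝟎 𝟎)
  defect∈span y y′ = subst InSpan eq
    (span-⊕ (C⊆span (join-ψ∈C (y ⊕ y′) 𝟎))
            (span-· 𝟚 (span-⊕ (C⊆span (join-ψ∈C y 𝟎)) (C⊆span (join-ψ∈C y′ 𝟎)))))
    where
    eq : join (ψ (y ⊕ y′)) (y ⊕ y′) 𝟎 ⊕ 𝟚 · (join (ψ y) y 𝟎 ⊕ join (ψ y′) y′ 𝟎)
       ≡ join (defect ψ y y′) 𝟎 𝟎
    eq = begin
      join (ψ (y ⊕ y′)) (y ⊕ y′) 𝟎 ⊕ 𝟚 · (join (ψ y) y 𝟎 ⊕ join (ψ y′) y′ 𝟎)
        ≡⟨ cong (λ w → join (ψ (y ⊕ y′)) (y ⊕ y′) 𝟎 ⊕ 𝟚 · w) (join-⊕ (ψ y) y 𝟎 (ψ y′) y′ 𝟎) ⟩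
      join (ψ (y ⊕ y′)) (y ⊕ y′) 𝟎 ⊕ 𝟚 · join (ψ y ⊕ ψ y′) (y ⊕ y′) (𝟎 ⊕ 𝟎)
        ≡⟨ cong (join (ψ (y ⊕ y′)) (y ⊕ y′) 𝟎 ⊕_) (join-· 𝟚 (ψ y ⊕ ψ y′) (y ⊕ y′) (𝟎 ⊕ 𝟎)) ⟩
      join (ψ (y ⊕ y′)) (y ⊕ y′) 𝟎 ⊕ join (𝟚 · (ψ y ⊕ ψ y′)) (𝟚 · (y ⊕ y′)) (𝟚 · (𝟎 ⊕ 𝟎))
        ≡⟨ join-⊕ (ψ (y ⊕ y′)) (y ⊕ y′) 𝟎 _ _ _ ⟩
      join (defect ψ y y′) ((y ⊕ y′) ⊕ 𝟚 · (y ⊕ y′)) (𝟎 ⊕ 𝟚 · (𝟎 ⊕ 𝟎))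
        ≡⟨ cong₂ (join (defect ψ y y′)) (⊕-inverseʳ (y ⊕ y′)) (trans (⊕-identityˡ _) (trans (cong (𝟚 ·_) (⊕-identityˡ 𝟎)) (·-𝟎 𝟚))) ⟩
      join (defect ψ y y′) 𝟎 𝟎 ∎

  defects∈span : ∀ {j} (a : Word j) (D D′ : Vec (Word m) j) →
    InSpan (join (linComb a (zipWith (defect ψ) D D′)) 𝟎 𝟎)
  defects∈span [] [] [] = C⊆span (subst (λ h → C (join h 𝟎 𝟎)) ψ-𝟎 (join-ψ∈C 𝟎 𝟎))
  defects∈span (a ∷ as) (y ∷ D) (y′ ∷ D′) =
    subst InSpan eq (span-⊕ (span-· a (defect∈span y y′)) (defects∈span as D D′))
    where
    d : Word 3
    d = defect ψ y y′
    h : Word 3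
    h = linComb as (zipWith (defect ψ) D D′)
    eq : a · join d 𝟎 𝟎 ⊕ join h 𝟎 𝟎 ≡ join (a · d ⊕ h) 𝟎 𝟎
    eq = begin
      a · join d 𝟎 𝟎 ⊕ join h 𝟎 𝟎                    ≡⟨ cong (_⊕ join h 𝟎 𝟎) (join-· a d 𝟎 𝟎) ⟩
      join (a · d) (a · 𝟎) (a · 𝟎) ⊕ join h 𝟎 𝟎      ≡⟨ join-⊕ (a · d) (a · 𝟎) (a · 𝟎) h 𝟎 𝟎 ⟩
      join (a · d ⊕ h) (a · 𝟎 ⊕ 𝟎) (a · 𝟎 ⊕ 𝟎)       ≡⟨ cong₂ (join (a · d ⊕ h)) (trans (⊕-identityʳ _) (·-𝟎 a)) (trans (⊕-identityʳ _) (·-𝟎 a)) ⟩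
      join (a · d ⊕ h) 𝟎 𝟎                           ∎

  -- Any x differs from the code word with the same `Y` and `Z` only in its `H` part, and the
  -- defects reach every such difference.
  isFullRank : (D D′ : Vec (Word m) 3) → zipWith (defect ψ) D D′ ≡ identity → IsFullRank C
  isFullRank D D′ defects≡I x = span⊆affineSpan (subst InSpan eq
    (span-⊕ (C⊆span (join-ψ∈C (Y x) (Z x))) (defects∈span h D D′)))
    where
    h : Word 3
    h = H x ⊕ 𝟚 · ψ (Y x)
    eq : join (ψ (Y x)) (Y x) (Z x) ⊕ join (linComb h (zipWith (defect ψ) D D′)) 𝟎 𝟎 ≡ x
    eq = begin
      join (ψ (Y x)) (Y x) (Z x) ⊕ join (linComb h (zipWith (defect ψ) D D′)) 𝟎 𝟎
        ≡⟨ cong (λ w → join (ψ (Y x)) (Y x) (Z x) ⊕ join w 𝟎 𝟎) (trans (cong (linComb h) defects≡I) (linComb-identity h)) ⟩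
      join (ψ (Y x)) (Y x) (Z x) ⊕ join h 𝟎 𝟎
        ≡⟨ join-⊕ (ψ (Y x)) (Y x) (Z x) h 𝟎 𝟎 ⟩
      join (ψ (Y x) ⊕ h) (Y x ⊕ 𝟎) (Z x ⊕ 𝟎)
        ≡⟨ cong₂ (join (ψ (Y x) ⊕ h)) (⊕-identityʳ (Y x)) (⊕-identityʳ (Z x)) ⟩
      join (ψ (Y x) ⊕ h) (Y x) (Z x)
        ≡⟨ cong (λ w → join w (Y x) (Z x)) (trans (⊕-comm (ψ (Y x)) h) (⊖-⊕ (H x) (ψ (Y x)))) ⟩
      join (H x) (Y x) (Z x)
        ≡⟨ join-HYZ x ⟩
      x ∎

  -- Periods, kernel and dimension

  K : Word n → Set
  K x = H x ≡ 𝟎 × Y x ≡ 𝟎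

  K-⊕ : ∀ u v → K u → K v → K (u ⊕ v)
  K-⊕ u v (Hu , Yu) (Hv , Yv) =
    trans (H-⊕ u v) (trans (cong₂ _⊕_ Hu Hv) (⊕-identityˡ 𝟎)) ,
    trans (Y-⊕ u v) (trans (cong₂ _⊕_ Yu Yv) (⊕-identityˡ 𝟎))

  K-· : ∀ a v → K v → K (a · v)
  K-· a v (Hv , Yv) =
    trans (H-· a v) (trans (cong (a ·_) Hv) (·-𝟎 a)) ,
    trans (Y-· a v) (trans (cong (a ·_) Yv) (·-𝟎 a))

  C-⊕-K : ∀ c w → K w → C c → C (c ⊕ w)
  C-⊕-K c w (Hw , Yw) c∈C = begin
    H (c ⊕ w)    ≡⟨ H-⊕ c w ⟩
    H c ⊕ H w    ≡⟨ trans (cong (H c ⊕_) Hw) (⊕-identityʳ (H c)) ⟩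
    H c          ≡⟨ c∈C ⟩
    ψ (Y c)      ≡⟨ cong ψ (trans (cong (Y c ⊕_) Yw) (⊕-identityʳ (Y c))) ⟨
    ψ (Y c ⊕ Y w) ≡⟨ cong ψ (Y-⊕ c w) ⟨
    ψ (Y (c ⊕ w)) ∎

  K⊆periods : K ⊆ IsPeriod C
  K⊆periods w w∈K = (λ c → C-⊕-K c w w∈K) ,
    λ x x∈C → x ⊕ 𝟚 · w , C-⊕-K x (𝟚 · w) (K-· 𝟚 w w∈K) x∈C , sym (⊖-⊕ x w)

  -- Every y is the `Y` part of some code word c with `H c` = ψ y; the identity is the code equation
  -- of c + w.
  period-additive : ∀ w → IsPeriod C w → ∀ y → ψ y ⊕ H w ≡ ψ (y ⊕ Y w)
  period-additive w (C+w⊆C , _) y = begin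
    ψ y ⊕ H w      ≡⟨ cong (_⊕ H w) (H-join (ψ y) y 𝟎) ⟨
    H c ⊕ H w      ≡⟨ H-⊕ c w ⟨
    H (c ⊕ w)      ≡⟨ C+w⊆C c (join-ψ∈C y 𝟎) ⟩
    ψ (Y (c ⊕ w))  ≡⟨ cong ψ (trans (Y-⊕ c w) (cong (_⊕ Y w) (Y-join (ψ y) y 𝟎))) ⟩
    ψ (y ⊕ Y w)    ∎
    where
    c : Word n
    c = join (ψ y) y 𝟎

  module Kernel (aperiodic : Aperiodic ψ) where

    -- At y = 0 `period-additive` gives `H w` = ψ (Y w). Substituting this back makes `Y w` an
    -- additive vector of ψ, which aperiodicity forces to be 0.
    periods⊆K : IsPeriod C ⊆ K
    periods⊆K w period = Hw≡𝟎 , Yw≡𝟎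
      where
      Hw≡ψYw : H w ≡ ψ (Y w)
      Hw≡ψYw = begin
        H w            ≡⟨ trans (cong (_⊕ H w) ψ-𝟎) (⊕-identityˡ (H w)) ⟨
        ψ 𝟎 ⊕ H w      ≡⟨ period-additive w period 𝟎 ⟩
        ψ (𝟎 ⊕ Y w)    ≡⟨ cong ψ (⊕-identityˡ (Y w)) ⟩
        ψ (Y w)        ∎
      Yw≡𝟎 : Y w ≡ 𝟎
      Yw≡𝟎 = aperiodic (Y w) (All.universal
        (λ y → trans (sym (period-additive w period y)) (cong (ψ y ⊕_) Hw≡ψYw)) identity)
      Hw≡𝟎 : H w ≡ 𝟎
      Hw≡𝟎 = trans Hw≡ψYw (trans (cong ψ Yw≡𝟎) ψ-𝟎)

    isKernel : IsKernel C K
    isKernel = ((H-𝟎 , Y-𝟎) , K-⊕ , K-·) , K⊆periods ,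
      λ L _ L⊆periods w w∈L → periods⊆K w (L⊆periods w w∈L)

  -- The last k rows of `R` are the words with `H` = 0, `Y` = 0 and `Z` a unit vector.
  B : Vec (Word n) k
  B = drop m (drop 3 R)

  linComb-B : ∀ z → linComb z B ≡ join 𝟎 𝟎 z
  linComb-B z = begin
    linComb z B                                                  ≡⟨ ⊕-identityˡ _ ⟨
    𝟎 ⊕ linComb z B                                              ≡⟨ cong (_⊕ linComb z B) (linComb-𝟎 (take m R′)) ⟨
    linComb 𝟎 (take m R′) ⊕ linComb z B                          ≡⟨ linComb-++ 𝟎 z (take m R′) B ⟨
    linComb (𝟎 {m} ++ z) (take m R′ ++ B)                        ≡⟨ cong (linComb (𝟎 {m} ++ z)) (take++drop≡id m R′) ⟩
    linComb (𝟎 {m} ++ z) R′                                      ≡⟨ ⊕-identityˡ _ ⟨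
    𝟎 ⊕ linComb (𝟎 {m} ++ z) R′                                  ≡⟨ cong (_⊕ linComb (𝟎 {m} ++ z) R′) (linComb-𝟎 (take 3 R)) ⟨
    linComb 𝟎 (take 3 R) ⊕ linComb (𝟎 {m} ++ z) R′               ≡⟨ linComb-++ 𝟎 (𝟎 {m} ++ z) (take 3 R) R′ ⟨
    linComb (𝟎 {3} ++ (𝟎 {m} ++ z)) (take 3 R ++ R′)             ≡⟨ cong (linComb (𝟎 {3} ++ (𝟎 {m} ++ z))) (take++drop≡id 3 R) ⟩
    join 𝟎 𝟎 z                                                   ∎
    where
    R′ : Vec (Word n) (m + k)
    R′ = drop 3 R

  hasDimension : HasDimension K k
  hasDimension = B , independent , span⊆K , K⊆span
    where
    independent : LinearlyIndependent B
    independent z eq = begin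
      z                         ≡⟨ Z-join 𝟎 𝟎 z ⟨
      Z (join 𝟎 𝟎 z)            ≡⟨ cong Z (trans (sym (linComb-B z)) eq) ⟩
      Z 𝟎                       ≡⟨ cong Z (trans (sym (linComb-𝟎 B)) (linComb-B 𝟎)) ⟩
      Z (join 𝟎 𝟎 𝟎)            ≡⟨ Z-join 𝟎 𝟎 𝟎 ⟩
      𝟎                         ∎
    span⊆K : Span B ⊆ K
    span⊆K x (z , refl) =
      trans (cong H (linComb-B z)) (H-join 𝟎 𝟎 z) , trans (cong Y (linComb-B z)) (Y-join 𝟎 𝟎 z)
    K⊆span : K ⊆ Span B
    K⊆span x (Hx , Yx) = Z x , (begin
      linComb (Z x) B          ≡⟨ linComb-B (Z x) ⟩
      join 𝟎 𝟎 (Z x)           ≡⟨ cong₂ (λ h y → join h y (Z x)) Hx Yx ⟨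
      join (H x) (Y x) (Z x)   ≡⟨ join-HYZ x ⟩
      x                        ∎)

-- The codes of length 13

points : Vec (Word 3) 13
points =
  (𝟘 ∷ 𝟘 ∷ 𝟙 ∷ []) ∷ (𝟘 ∷ 𝟙 ∷ 𝟘 ∷ []) ∷ (𝟘 ∷ 𝟙 ∷ 𝟙 ∷ []) ∷ (𝟘 ∷ 𝟙 ∷ 𝟚 ∷ []) ∷
  (𝟙 ∷ 𝟘 ∷ 𝟘 ∷ []) ∷ (𝟙 ∷ 𝟘 ∷ 𝟙 ∷ []) ∷ (𝟙 ∷ 𝟘 ∷ 𝟚 ∷ []) ∷
  (𝟙 ∷ 𝟙 ∷ 𝟘 ∷ []) ∷ (𝟙 ∷ 𝟙 ∷ 𝟙 ∷ []) ∷ (𝟙 ∷ 𝟙 ∷ 𝟚 ∷ []) ∷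
  (𝟙 ∷ 𝟚 ∷ 𝟘 ∷ []) ∷ (𝟙 ∷ 𝟚 ∷ 𝟙 ∷ []) ∷ (𝟙 ∷ 𝟚 ∷ 𝟚 ∷ []) ∷ []

-- Together with x, y, z these form a basis of the odd functions on F₃³.
oddPolynomials : Word 3 → Word 10
oddPolynomials (x ∷ y ∷ z ∷ []) =
  x *₃ z *₃ z ∷ x *₃ x *₃ y ∷ y *₃ y *₃ z ∷
  x *₃ x *₃ y *₃ z *₃ z ∷ y *₃ z *₃ z ∷
  x *₃ y *₃ z +₃ -₃ (x *₃ y *₃ y *₃ z *₃ z) ∷ x *₃ y *₃ z +₃ x *₃ y *₃ y *₃ z *₃ z ∷
  x *₃ y *₃ y ∷ x *₃ x *₃ z ∷ x *₃ x *₃ y *₃ y *₃ z ∷ []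

M₁₃ : Vec (Word 13) 13
M₁₃ = map (λ p → p ++ oddPolynomials p) points

-- The inverse of `M₁₃`. It exists because an odd function is determined by its values on `points`
-- and the 13 columns of `M₁₃` come from a basis of the odd functions.
R₁₃ : Vec (Word 13) 13
R₁₃ =
  (𝟘 ∷ 𝟘 ∷ 𝟘 ∷ 𝟘 ∷ 𝟙 ∷ 𝟘 ∷ 𝟘 ∷ 𝟘 ∷ 𝟘 ∷ 𝟘 ∷ 𝟘 ∷ 𝟘 ∷ 𝟘 ∷ []) ∷
  (𝟘 ∷ 𝟙 ∷ 𝟘 ∷ 𝟘 ∷ 𝟘 ∷ 𝟘 ∷ 𝟘 ∷ 𝟘 ∷ 𝟘 ∷ 𝟘 ∷ 𝟘 ∷ 𝟘 ∷ 𝟘 ∷ []) ∷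
  (𝟙 ∷ 𝟘 ∷ 𝟘 ∷ 𝟘 ∷ 𝟘 ∷ 𝟘 ∷ 𝟘 ∷ 𝟘 ∷ 𝟘 ∷ 𝟘 ∷ 𝟘 ∷ 𝟘 ∷ 𝟘 ∷ []) ∷
  (𝟘 ∷ 𝟘 ∷ 𝟘 ∷ 𝟘 ∷ 𝟚 ∷ 𝟚 ∷ 𝟚 ∷ 𝟘 ∷ 𝟘 ∷ 𝟘 ∷ 𝟘 ∷ 𝟘 ∷ 𝟘 ∷ []) ∷
  (𝟘 ∷ 𝟚 ∷ 𝟘 ∷ 𝟘 ∷ 𝟘 ∷ 𝟘 ∷ 𝟘 ∷ 𝟚 ∷ 𝟘 ∷ 𝟘 ∷ 𝟙 ∷ 𝟘 ∷ 𝟘 ∷ []) ∷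
  (𝟚 ∷ 𝟘 ∷ 𝟚 ∷ 𝟙 ∷ 𝟘 ∷ 𝟘 ∷ 𝟘 ∷ 𝟘 ∷ 𝟘 ∷ 𝟘 ∷ 𝟘 ∷ 𝟘 ∷ 𝟘 ∷ []) ∷
  (𝟘 ∷ 𝟙 ∷ 𝟙 ∷ 𝟙 ∷ 𝟘 ∷ 𝟘 ∷ 𝟘 ∷ 𝟙 ∷ 𝟙 ∷ 𝟙 ∷ 𝟚 ∷ 𝟚 ∷ 𝟚 ∷ []) ∷
  (𝟘 ∷ 𝟚 ∷ 𝟚 ∷ 𝟚 ∷ 𝟘 ∷ 𝟘 ∷ 𝟘 ∷ 𝟘 ∷ 𝟘 ∷ 𝟘 ∷ 𝟘 ∷ 𝟘 ∷ 𝟘 ∷ []) ∷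
  (𝟘 ∷ 𝟘 ∷ 𝟘 ∷ 𝟘 ∷ 𝟙 ∷ 𝟙 ∷ 𝟙 ∷ 𝟙 ∷ 𝟘 ∷ 𝟚 ∷ 𝟙 ∷ 𝟚 ∷ 𝟘 ∷ []) ∷
  (𝟘 ∷ 𝟘 ∷ 𝟘 ∷ 𝟘 ∷ 𝟚 ∷ 𝟚 ∷ 𝟚 ∷ 𝟚 ∷ 𝟙 ∷ 𝟘 ∷ 𝟚 ∷ 𝟘 ∷ 𝟙 ∷ []) ∷
  (𝟘 ∷ 𝟘 ∷ 𝟘 ∷ 𝟘 ∷ 𝟚 ∷ 𝟘 ∷ 𝟘 ∷ 𝟚 ∷ 𝟘 ∷ 𝟘 ∷ 𝟚 ∷ 𝟘 ∷ 𝟘 ∷ []) ∷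
  (𝟚 ∷ 𝟘 ∷ 𝟘 ∷ 𝟘 ∷ 𝟘 ∷ 𝟚 ∷ 𝟙 ∷ 𝟘 ∷ 𝟘 ∷ 𝟘 ∷ 𝟘 ∷ 𝟘 ∷ 𝟘 ∷ []) ∷
  (𝟙 ∷ 𝟘 ∷ 𝟙 ∷ 𝟚 ∷ 𝟘 ∷ 𝟙 ∷ 𝟚 ∷ 𝟘 ∷ 𝟙 ∷ 𝟚 ∷ 𝟘 ∷ 𝟙 ∷ 𝟚 ∷ []) ∷ []

M⊡R : M₁₃ ⊡ R₁₃ ≡ identity
M⊡R = refl

R⊡M : R₁₃ ⊡ M₁₃ ≡ identity
R⊡M = refl

-- The nonlinear function and its variables

ifZero_then_else_ : ∀ {A : Set} → F₃ → A → A → A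
ifZero zero then p else q = p
ifZero suc _ then p else q = q

-- Think of adding p to x, then q to y, then r to z: x moves only where m₃ = 0, y only where the
-- updated value m₁ − p is 0, and z only where the updated value m₂ − q is 0.
ψ₇ : Word 7 → Word 3
ψ₇ (m₁ ∷ m₂ ∷ m₃ ∷ s ∷ b ∷ t ∷ w ∷ []) =
  -- Each argument is read as a constant minus the matching entry of `oddPolynomials` at (x , y ,
  -- z). Then `m₃` and `b` do not involve x, and where x moves, x + p is affine in x with slope 1 +
  -- z² + yz + y²z² or 1 + yz - y²z². Neither vanishes over F₃, nor do the slopes 1 + z² and 1 left
  -- when `w` or `t` is set to 0.
  moveX (ifZero m₃ then -₃ (ifZero b then m₁ +₃ w else t) else 𝟘)
  where
  moveY : F₃ → F₃ → Word 3
  -- If `m₃` ≠ 0, then p = 0 and x has not moved; if `m₃` = 0, then r = 0. For x ≠ 0 the test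
  -- depends on y only through y + q. Where it succeeds, z + r is affine in z with slope 1 + y²,
  -- which is nonzero.
  moveY p q = p ∷ q ∷ (ifZero m₂ +₃ -₃ q then -₃ m₃ else 𝟘) ∷ []
  moveX : F₃ → Word 3
  -- For z ≠ 0 the test sees x only through x + p; for z = 0 it is constant. Where it succeeds, y +
  -- q is affine in y with slope 1 + x² (1 - z²), or 1 + x² if `s` is set to 0; both are nonzero.
  moveX p = moveY p (ifZero m₁ +₃ -₃ p then s +₃ -₃ m₂ else 𝟘)

-- Truncates or pads with zeros, whichever the lengths require: it cuts `oddPolynomials` down to m
-- components and fills the missing variables of `ψ₇` with 0.
resize : ∀ {i} j → Word i → Word j
resize zero _ = []
resize (suc j) [] = 𝟘 ∷ resize j []
resize (suc j) (a ∷ w) = a ∷ resize j w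

resize-take : ∀ m {k} (w : Word (m + k)) → take m w ≡ resize m w
resize-take zero w = refl
resize-take (suc m) (a ∷ w) = cong (a ∷_) (resize-take m w)

ψ : ∀ m → Word m → Word 3
ψ m y = ψ₇ (resize 7 y)

-- For `points`, a nonzero u is p or -p for exactly one point p, where the entry 1 or -1 is placed.
-- For u = 0 every test fails and the result is the zero word.
locate : ∀ {n} → Vec (Word 3) n → Word 3 → Word n
locate [] u = []
locate (p ∷ ps) u =
  if does (u ≟ʷ p) then 𝟙 ∷ 𝟎 else
  if does (u ≟ʷ 𝟚 · p) then 𝟚 ∷ 𝟎 else 𝟘 ∷ locate ps u

locate-sparse : ∀ {n} (ps : Vec (Word 3) n) u → Sparse (locate ps u)
locate-sparse [] u = []
locate-sparse (p ∷ ps) u with does (u ≟ʷ p) | does (u ≟ʷ 𝟚 · p)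
... | true  | _     = here 𝟙
... | false | true  = here 𝟚
... | false | false = there (locate-sparse ps u)

error : Word 3 → Word 13
error = locate points

-- This is where oddness enters: an entry -1 at the point p negates the row of p, and
-- -`oddPolynomials` p is `oddPolynomials` at -p.
M₁₃-error : ∀ u → linComb (error u) M₁₃ ≡ u ++ oddPolynomials u
M₁₃-error = toWitness {a? = allWords? λ u → linComb (error u) M₁₃ ≟ʷ u ++ oddPolynomials u} _

error-M₁₃ : ∀ b → Sparse b → error (take 3 (linComb b M₁₃)) ≡ b
error-M₁₃ = toWitness {a? = allSparse? λ b → error (take 3 (linComb b M₁₃)) ≟ʷ b} _

-- The defects at these pairs are the three unit vectors.
defectsˡ : ∀ m → Vec (Word m) 3
defectsˡ m = map (resize m) ((𝟘 ∷ 𝟘 ∷ 𝟙 ∷ []) ∷ (𝟘 ∷ 𝟙 ∷ 𝟘 ∷ []) ∷ (𝟘 ∷ 𝟘 ∷ 𝟙 ∷ []) ∷ [])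

defectsʳ : ∀ m → Vec (Word m) 3
defectsʳ m = map (resize m) ((𝟙 ∷ 𝟘 ∷ 𝟘 ∷ []) ∷ (𝟙 ∷ 𝟘 ∷ 𝟘 ∷ []) ∷ (𝟘 ∷ 𝟙 ∷ 𝟘 ∷ []) ∷ [])

-- For concrete m + k = 10 the arguments M, R and P are always M₁₃, R₁₃ and oddPolynomials.
syndromeCode :
  ∀ m k (M : Vec (Word (3 + (m + k))) 13) (R : Vec (Word 13) (3 + (m + k))) (P : Word 3 → Word (m + k)) →
  M ⊡ R ≡ identity → R ⊡ M ≡ identity →
  (∀ u → linComb (error u) M ≡ u ++ P u) →
  (∀ b → Sparse b → error (take 3 (linComb b M)) ≡ b) →
  ψ m 𝟎 ≡ 𝟎 →
  zipWith (defect (ψ m)) (defectsˡ m) (defectsʳ m) ≡ identity →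
  Aperiodic (ψ m) →
  Permutes (λ u → resize m (P u)) (ψ m) →
  Σ (Code 13) λ C → IsPerfect1 C × IsFullRank C × Σ (Word 13 → Set) λ K → IsKernel C K × HasDimension K k
syndromeCode m k M R P MR RM M-error error-M ψ-𝟎 defects aperiodic permutes =
  C , isPerfect1 , isFullRank (defectsˡ m) (defectsʳ m) defects , K , isKernel , hasDimension
  where
  open SyndromeCode m k M R MR RM (ψ m) ψ-𝟎
  open Kernel aperiodic
  open Perfect (λ u → resize m (P u)) permutes error (locate-sparse points)
    (λ u → trans (cong (take 3) (M-error u)) (take-++ u (P u)))
    (λ u → trans (cong (take m) (trans (cong (drop 3) (M-error u)) (drop-++ u (P u)))) (resize-take m (P u)))
    error-M

theorem3 : ∀ (k : ℕ) → 3 ≤ k → k ≤ 7 →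
    Σ (Code 13) λ C →
    IsPerfect1 C × IsFullRank C ×
    Σ (Word 13 → Set) λ K → IsKernel C K × HasDimension K k
theorem3 0 () _
theorem3 1 (s≤s ()) _
theorem3 2 (s≤s (s≤s ())) _
theorem3 3 _ _ =
  syndromeCode 7 3 M₁₃ R₁₃ oddPolynomials M⊡R R⊡M M₁₃-error error-M₁₃ refl refl
    (toWitness {a? = aperiodic? (ψ 7)} _) (toWitness {a? = permutes? (λ u → resize 7 (oddPolynomials u)) (ψ 7)} _)
theorem3 4 _ _ =
  syndromeCode 6 4 M₁₃ R₁₃ oddPolynomials M⊡R R⊡M M₁₃-error error-M₁₃ refl refl
    (toWitness {a? = aperiodic? (ψ 6)} _) (toWitness {a? = permutes? (λ u → resize 6 (oddPolynomials u)) (ψ 6)} _)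
theorem3 5 _ _ =
  syndromeCode 5 5 M₁₃ R₁₃ oddPolynomials M⊡R R⊡M M₁₃-error error-M₁₃ refl refl
    (toWitness {a? = aperiodic? (ψ 5)} _) (toWitness {a? = permutes? (λ u → resize 5 (oddPolynomials u)) (ψ 5)} _)
theorem3 6 _ _ =
  syndromeCode 4 6 M₁₃ R₁₃ oddPolynomials M⊡R R⊡M M₁₃-error error-M₁₃ refl refl
    (toWitness {a? = aperiodic? (ψ 4)} _) (toWitness {a? = permutes? (λ u → resize 4 (oddPolynomials u)) (ψ 4)} _)
theorem3 7 _ _ =
  syndromeCode 3 7 M₁₃ R₁₃ oddPolynomials M⊡R R⊡M M₁₃-error error-M₁₃ refl refl
    (toWitness {a? = aperiodic? (ψ 3)} _) (toWitness {a? = permutes? (λ u → resize 3 (oddPolynomials u)) (ψ 3)} _)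
theorem3 (suc (suc (suc (suc (suc (suc (suc (suc _)))))))) _ (s≤s (s≤s (s≤s (s≤s (s≤s (s≤s (s≤s ())))))))
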